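{- Let $\mathcal{F}_0$ and $\mathcal{F}_1$ be filters on $\omega$ containing the Fréchet filter, and let $\mathcal{B}\subseteq\omega^\omega$ be unbounded. If $\mathcal{F}_0\oplus\mathcal{F}_1$ is $\mathcal{B}$-Canjar, then Mathias forcing $\mathbb{M}(\mathcal{F}_1)$ with respect to $\mathcal{F}_1$ forces "$\mathcal{F}_0$ is $\mathcal{B}$-Canjar".
   Context: Filters on $\omega$ are proper and contain the Fréchet filter (of cofinite sets). $\mathcal{B}\subseteq\omega^\omega$ is unbounded if there is no $g\in\omega^\omega$ with $f\leq^* g$ for all $f\in\mathcal{B}$, where $f\leq^* g$ means $f(n)\leq g(n)$ for all but finitely many $n$. Mathias forcing $\mathbb{M}(\mathcal{F})$ is the set of pairs $(s,A)$ with $s\in 2^{<\omega}$ and $A\in\mathcal{F}$, ordered by: $(t,B)\leq(s,A)$ iff $t$ extends $s$, $B\subseteq A$, and for each $n\geq|s|$ with $t(n)=1$ we have $n\in A$. $\mathcal{F}$ is $\mathcal{B}$-Canjar if $\mathbb{M}(\mathcal{F})$ forces that $\mathcal{B}$ is (still) unbounded. In a forcing extension, "$\mathcal{F}_0$ is $\mathcal{B}$-Canjar" refers to the filter generated by $\mathcal{F}_0$ in that extension. For $A,B\subseteq\omega$ let $A\oplus B=\{2n: n\in A\}\cup\{2m+1: m\in B\}$, and $\mathcal{F}_0\oplus\mathcal{F}_1=\{A\oplus B: A\in\mathcal{F}_0, B\in\mathcal{F}_1\}$ (which is again a filter). -}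

module Defs where

open import Axiom.ExcludedMiddle using (ExcludedMiddle)
open import Data.Bool using (Bool; true; T)
open import Data.Fin using (Fin; toℕ)
open import Data.List using (List; length; lookup)
open import Data.List.Relation.Binary.Prefix.Heterogeneous using (Prefix)
open import Data.Nat using (ℕ; _+_; _*_; _≤_)
open import Data.Product using (_×_; _,_; proj₁; proj₂)
open import Level using (0ℓ)
open import Relation.Binary.PropositionalEquality using (_≡_)
open import Relation.Nullary using (¬_; does)

-- "𝓕 is 𝓑-Canjar" has to be read both in the ground model V and in a forcing
-- extension of V, and it is itself about a further extension.  So all notions
-- are defined relative to an arbitrary universe: a classical logic together with
-- sets of finite type over ω.  The primitive connectives are ∧, ~ and ⋀; the
-- others are defined from them classically, as is usual for forcing.
--
-- Ω             truth values (the meanings of sentences);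
-- ⌜ A ⌝         an absolute fact about ground objects such as numbers;
-- Sub A         sets presented by listing elements of A.  In an extension these
--               are the names all of whose elements have their names in A;
-- X ∋ a         a itself is listed in X.  Genuine membership, which is closed
--               under equality of the universe, is _∈[_]_ below;
-- sep φ         the set { a : A | φ a }.
record Universe : Set₂ where
  infix  6 _∋_
  infix  5 ~_
  infixr 4 _∧_
  field
    Ω   : Set₁
    ⌜_⌝ : Set → Ω
    _∧_ : Ω → Ω → Ω
    ~_  : Ω → Ω
    ⋀   : {I : Set} → (I → Ω) → Ω
    Sub : Set → Set
    _∋_ : {A : Set} → Sub A → A → Ω
    sep : {A : Set} → (A → Ω) → Sub A

  infixr 3 _∨_
  infixr 2 _⇒_
  infix  1 _⇔_

  _∨_ _⇒_ _⇔_ : Ω → Ω → Ω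
  φ ∨ ψ = ~ (~ φ ∧ ~ ψ)
  φ ⇒ ψ = ~ (φ ∧ ~ ψ)
  φ ⇔ ψ = (φ ⇒ ψ) ∧ (ψ ⇒ φ)

  ⋁ : {I : Set} → (I → Ω) → Ω
  ⋁ φ = ~ (⋀ λ i → ~ φ i)

-- The ground model.  Under excluded middle, Bool-valued characteristic functions
-- are arbitrary subsets, and all the iterated power sets are small.
V : ExcludedMiddle 0ℓ → Universe
V em = record
  { Ω   = Set
  ; ⌜_⌝ = λ A → A
  ; _∧_ = _×_
  ; ~_  = ¬_
  ; ⋀   = λ {I} φ → (i : I) → φ i
  ; Sub = λ A → A → Bool
  ; _∋_ = λ X a → T (X a)
  ; sep = λ φ a → does (em {φ a})
  }

-- Elements of base A are (canonical names of) elements of the ground set A.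
data Ty : Set₁ where
  base : Set → Ty
  𝒫    : Ty → Ty

ω ω×ω Pω Pω×ω : Ty
ω    = base ℕ
ω×ω  = base (ℕ × ℕ)
Pω   = 𝒫 ω
Pω×ω = 𝒫 ω×ω

module _ (U : Universe) where
  open Universe U

  El : Ty → Set
  El (base A) = A
  El (𝒫 τ)    = Sub (El τ)

  -- A notion of forcing whose conditions are the p : Cond with Valid p; the order
  -- is only ever used between valid conditions.
  record Forcing : Set₁ where
    field
      Cond  : Set
      Valid : Cond → Ω
      _≼_   : Cond → Cond → Ω

module Sets (U : Universe) where
  open Universe U

  infix 6 eq mem

  mutual
    eq : (τ : Ty) → El U τ → El U τ → Ω
    eq (base A) x y = ⌜ x ≡ y ⌝
    eq (𝒫 τ)    X Y = ⋀ λ z → mem τ z X ⇔ mem τ z Y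

    mem : (τ : Ty) → El U τ → El U (𝒫 τ) → Ω
    mem τ x X = ⋁ λ y → X ∋ y ∧ eq τ y x

  syntax eq τ x y  = x ≈[ τ ] y
  syntax mem τ x X = x ∈[ τ ] X

  _⊆_ : El U Pω → El U Pω → Ω
  A ⊆ B = ⋀ λ n → n ∈[ ω ] A ⇒ n ∈[ ω ] B

  _∩_ : El U Pω → El U Pω → El U Pω
  A ∩ B = sep λ n → n ∈[ ω ] A ∧ n ∈[ ω ] B

  -- n ∈ A for all but finitely many n
  Cofinite : El U Pω → Ω
  Cofinite A = ⋁ λ N → ⋀ λ n → ⌜ N ≤ n ⌝ ⇒ n ∈[ ω ] A

  IsFilter : El U (𝒫 Pω) → Ω
  IsFilter 𝓕 =
      (⋀ λ A → Cofinite A ⇒ A ∈[ Pω ] 𝓕)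
    ∧ (⋀ λ A → A ∈[ Pω ] 𝓕 ⇒ ⋁ λ n → n ∈[ ω ] A)
    ∧ (⋀ λ A → ⋀ λ B → A ∈[ Pω ] 𝓕 ⇒ A ⊆ B ⇒ B ∈[ Pω ] 𝓕)
    ∧ (⋀ λ A → ⋀ λ B → A ∈[ Pω ] 𝓕 ⇒ B ∈[ Pω ] 𝓕 ⇒ (A ∩ B) ∈[ Pω ] 𝓕)

  -- The filter generated by 𝓖: all supersets of intersections of finitely many
  -- members of 𝓖.
  generated : El U (𝒫 Pω) → El U (𝒫 Pω)
  generated 𝓖 = sep λ A → ⋁ λ (Xs : List (El U Pω)) →
      (⋀ λ i → lookup Xs i ∈[ Pω ] 𝓖)
    ∧ (⋀ λ n → (⋀ λ i → n ∈[ ω ] lookup Xs i) ⇒ n ∈[ ω ] A)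

  _⊕_ : El U Pω → El U Pω → El U Pω
  A ⊕ B = sep λ k →
      (⋁ λ n → n ∈[ ω ] A ∧ ⌜ k ≡ 2 * n ⌝)
    ∨ (⋁ λ m → m ∈[ ω ] B ∧ ⌜ k ≡ 2 * m + 1 ⌝)

  _⊕ᶠ_ : El U (𝒫 Pω) → El U (𝒫 Pω) → El U (𝒫 Pω)
  𝓕₀ ⊕ᶠ 𝓕₁ = sep λ C → ⋁ λ A → ⋁ λ B →
    A ∈[ Pω ] 𝓕₀ ∧ B ∈[ Pω ] 𝓕₁ ∧ C ≈[ Pω ] (A ⊕ B)

  -- Elements of ω^ω are functional relations f ⊆ ω × ω.
  IsReal : El U Pω×ω → Ω
  IsReal f =
      (⋀ λ n → ⋁ λ m → (n , m) ∈[ ω×ω ] f)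
    ∧ (⋀ λ n → ⋀ λ m → ⋀ λ m′ →
         (n , m) ∈[ ω×ω ] f ⇒ (n , m′) ∈[ ω×ω ] f ⇒ ⌜ m ≡ m′ ⌝)

  AllReal : El U (𝒫 Pω×ω) → Ω
  AllReal 𝓑 = ⋀ λ f → f ∈[ Pω×ω ] 𝓑 ⇒ IsReal f

  _≤*_ : El U Pω×ω → El U Pω×ω → Ω
  f ≤* g = ⋁ λ N → ⋀ λ n → ⌜ N ≤ n ⌝ ⇒ ⋀ λ m → ⋀ λ k →
    (n , m) ∈[ ω×ω ] f ⇒ (n , k) ∈[ ω×ω ] g ⇒ ⌜ m ≤ k ⌝

  Unbounded : El U (𝒫 Pω×ω) → Ω
  Unbounded 𝓑 = ~ ⋁ λ g → IsReal g ∧ ⋀ λ f → f ∈[ Pω×ω ] 𝓑 ⇒ f ≤* g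

-- The universe of ℙ-names over U, a sentence being interpreted as the predicate
-- "p forces it" on conditions p.  A name for a set is, as usual, a set of pairs
-- (name, condition).  Unfolding ⋁, genuine membership becomes the familiar
-- clause: p ⊩ x ∈ X iff the q such that q ≼ r and q ⊩ y ≈ x for some (y , r) in X
-- are dense below p.
_[_] : (U : Universe) → Forcing U → Universe
U [ ℙ ] = record
  { Ω   = Cond → Ω
  ; ⌜_⌝ = λ A p → ⌜ A ⌝
  ; _∧_ = λ φ ψ p → φ p ∧ ψ p
  ; ~_  = λ φ p → ⋀ λ q → ~ (Valid q ∧ q ≼ p ∧ φ q)
  ; ⋀   = λ φ p → ⋀ λ i → φ i p
  ; Sub = λ A → Sub (A × Cond)
  ; _∋_ = λ X y p → ⋁ λ r → X ∋ (y , r) ∧ Valid r ∧ p ≼ r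
  ; sep = λ φ → sep λ (x , p) → φ x p
  }
  where
  open Universe U
  open Forcing ℙ

module Extension (U : Universe) (ℙ : Forcing U) where
  open Universe U
  open Forcing ℙ

  -- The canonical name x̌ of x; for sets, X̌ = { (x̌ , p) : x ∈ X, p a condition }.
  check : (τ : Ty) → El U τ → El (U [ ℙ ]) τ
  check (base A) x = x
  check (𝒫 τ)    X = sep λ (z , p) → Valid p ∧ ⋁ λ x → X ∋ x ∧ ⌜ z ≡ check τ x ⌝

  Forces : Universe.Ω (U [ ℙ ]) → Ω
  Forces φ = ⋀ λ p → Valid p ⇒ φ p

module _ (U : Universe) where
  open Universe U
  open Sets U

  Mathias : El U (𝒫 Pω) → Forcing U
  Mathias 𝓕 = record
    { Cond  = List Bool × El U Pω
    ; Valid = λ (s , A) → A ∈[ Pω ] 𝓕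
    ; _≼_   = λ (t , B) (s , A) →
          ⌜ Prefix _≡_ s t ⌝
        ∧ B ⊆ A
        ∧ (⋀ λ (i : Fin (length t)) →
             ⌜ length s ≤ toℕ i ⌝ ⇒ ⌜ lookup t i ≡ true ⌝ ⇒ toℕ i ∈[ ω ] A)
    }

  -- Mathias forcing with respect to 𝓕 forces that 𝓑 is still unbounded.
  Canjar : El U (𝒫 Pω×ω) → El U (𝒫 Pω) → Ω
  Canjar 𝓑 𝓕 = Forces (Sets.Unbounded (U [ Mathias 𝓕 ]) (check (𝒫 Pω×ω) 𝓑))
    where open Extension U (Mathias 𝓕)

module Submission where

-- Splitting a condition of 𝕄(𝓕₀ ⊕ 𝓕₁) into its even and odd parts is an order-preserving
-- map into the iteration 𝕄(𝓕₁) * 𝕄(𝓕̌₀).  It is a projection: a condition of the iteration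
-- below the image of (u , C) has the form ((s , A) , (t , Ȧ)); strengthening the first step
-- decides some X ∈ 𝓕₀ with X ⊆ Ȧ, and interleaving t with s, both padded by zeros (which
-- is always allowed), and taking the sum of X, cut down to the even part of C, with A gives a
-- condition below (u , C) whose image lies below the given one.  Hence a name for a bound of 𝓑
-- in the iteration can be pulled back to an 𝕄(𝓕₀ ⊕ 𝓕₁)-name for a bound of 𝓑.

open import Axiom.ExcludedMiddle using (ExcludedMiddle)
open import Data.Bool using (Bool; true; false; T)
open import Data.Empty using (⊥-elim)
open import Data.Fin using (Fin; zero; suc; toℕ; fromℕ<)
open import Data.Fin.Properties using (toℕ-fromℕ<)
open import Data.List using (List; []; _∷_; length; lookup; applyUpTo)
open import Data.List.Properties using (length-applyUpTo)
open import Data.List.Relation.Binary.Prefix.Heterogeneous using (Prefix; []; _∷_)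
open import Data.Nat
  using (ℕ; zero; suc; _+_; _*_; _≤_; _<_; z≤n; s≤s; ⌊_/2⌋; ⌈_/2⌉; _<?_)
open import Data.Nat.Properties
open import Data.Product using (Σ; ∃; _×_; _,_; proj₁; proj₂)
open import Data.Sum using (_⊎_; inj₁; inj₂)
open import Data.Unit using (⊤; tt)
open import Function using (_∘_; id)
open import Level using (0ℓ)
open import Relation.Binary.PropositionalEquality
  using (_≡_; refl; sym; trans; cong; subst; subst₂)
open import Relation.Nullary using (¬_; Dec; yes; no; does; contradiction)
open import Relation.Nullary.Decidable using (decidable-stable)

open import Defs

-- Finite binary sequences, with bits beyond the end read as false

bit : List Bool → ℕ → Bool
bit []       _       = false
bit (b ∷ _)  zero    = b
bit (_ ∷ bs) (suc i) = bit bs i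

bit-beyond : ∀ s {i} → length s ≤ i → bit s i ≡ false
bit-beyond []      _       = refl
bit-beyond (_ ∷ s) (s≤s l) = bit-beyond s l

bit-true⇒< : ∀ s {i} → bit s i ≡ true → i < length s
bit-true⇒< (_ ∷ _) {zero}  _ = s≤s z≤n
bit-true⇒< (_ ∷ s) {suc i} b = s≤s (bit-true⇒< s b)

bit-lookup : ∀ s (i : Fin (length s)) → bit s (toℕ i) ≡ lookup s i
bit-lookup (_ ∷ _) zero    = refl
bit-lookup (_ ∷ s) (suc i) = bit-lookup s i

bit-applyUpTo : ∀ (f : ℕ → Bool) n → (∀ i → n ≤ i → f i ≡ false) →
                ∀ i → bit (applyUpTo f n) i ≡ f i
bit-applyUpTo f zero    beyond i       = sym (beyond i z≤n)
bit-applyUpTo f (suc n) beyond zero    = refl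
bit-applyUpTo f (suc n) beyond (suc i) =
  bit-applyUpTo (f ∘ suc) n (λ j l → beyond (suc j) (s≤s l)) i

infix 4 _⊴_

-- Initial segments compared place by place: unlike the inductive `Prefix`, this form survives
-- reindexing along even or odd places.
_⊴_ : List Bool → List Bool → Set
s ⊴ t = (length s ≤ length t) × (∀ {i} → i < length s → bit t i ≡ bit s i)

⊴-refl : ∀ {s} → s ⊴ s
⊴-refl = ≤-refl , λ _ → refl

⊴-trans : ∀ {s t u} → s ⊴ t → t ⊴ u → s ⊴ u
⊴-trans (l , b) (l′ , b′) = ≤-trans l l′ , λ i< → trans (b′ (<-≤-trans i< l)) (b i<)

Prefix⇒⊴ : ∀ {s t} → Prefix _≡_ s t → s ⊴ t
Prefix⇒⊴ []                = z≤n , λ ()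
Prefix⇒⊴ (refl ∷ p) with l , b ← Prefix⇒⊴ p =
  s≤s l , λ { {zero} _ → refl ; {suc i} (s≤s i<) → b i< }

⊴⇒Prefix : ∀ s t → s ⊴ t → Prefix _≡_ s t
⊴⇒Prefix []      _       _             = []
⊴⇒Prefix (_ ∷ s) (_ ∷ t) (s≤s l , b) = sym (b (s≤s z≤n)) ∷ ⊴⇒Prefix s t (l , λ i< → b (s≤s i<))

-- Even and odd parts

double double+1 : ℕ → ℕ
double   i = i + i
double+1 i = suc (i + i)

data Parity : ℕ → Set where
  even : ∀ i → Parity (double i)
  odd  : ∀ i → Parity (double+1 i)

parity : ∀ n → Parity n
parity zero = even 0
parity (suc n) with parity n
... | even i = odd i
... | odd i  = subst Parity (cong suc (+-suc i i)) (even (suc i))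

double-injective : ∀ i j → double i ≡ double j → i ≡ j
double-injective i j eq =
  trans (n≡⌊n+n/2⌋ i) (trans (cong ⌊_/2⌋ eq) (sym (n≡⌊n+n/2⌋ j)))

-- Halving both sides gives `i ≡ j` when rounding down and `i ≡ suc j` when rounding up.
double≢double+1 : ∀ i j → ¬ double i ≡ double+1 j
double≢double+1 i j eq = 1+n≢n (trans (sym i≡1+j) i≡j)
  where
  i≡j : i ≡ j
  i≡j = trans (n≡⌊n+n/2⌋ i) (trans (cong ⌊_/2⌋ eq) (sym (n≡⌈n+n/2⌉ j)))
  i≡1+j : i ≡ suc j
  i≡1+j = trans (n≡⌈n+n/2⌉ i) (trans (cong ⌈_/2⌉ eq) (cong suc (sym (n≡⌊n+n/2⌋ j))))

2*≡double : ∀ n → 2 * n ≡ double n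
2*≡double n = cong (n +_) (+-identityʳ n)

2*+1≡double+1 : ∀ n → 2 * n + 1 ≡ double+1 n
2*+1≡double+1 n = trans (+-comm (2 * n) 1) (cong suc (2*≡double n))

≤double⌈/2⌉ : ∀ n → n ≤ double ⌈ n /2⌉
≤double⌈/2⌉ n = subst (_≤ double ⌈ n /2⌉) (⌊n/2⌋+⌈n/2⌉≡n n) (+-monoˡ-≤ _ (⌊n/2⌋≤⌈n/2⌉ n))

-- The length of the α-part of a sequence of length n is h n, where h ⊣ α.
record Part : Set where
  field
    α h     : ℕ → ℕ
    α-mono  : ∀ {i j} → i ≤ j → α i ≤ α j
    h-mono  : ∀ {m n} → m ≤ n → h m ≤ h n
    unit    : ∀ n → n ≤ α (h n)
    counit  : ∀ i → h (α i) ≤ i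

  h≤⇒≤α : ∀ {n i} → h n ≤ i → n ≤ α i
  h≤⇒≤α l = ≤-trans (unit _) (α-mono l)

  ≤α⇒h≤ : ∀ {n i} → n ≤ α i → h n ≤ i
  ≤α⇒h≤ l = ≤-trans (h-mono l) (counit _)

  part : List Bool → List Bool
  part u = applyUpTo (bit u ∘ α) (h (length u))

  length-part : ∀ u → length (part u) ≡ h (length u)
  length-part u = length-applyUpTo _ (h (length u))

  bit-part : ∀ u i → bit (part u) i ≡ bit u (α i)
  bit-part u = bit-applyUpTo _ _ (λ i l → bit-beyond u (h≤⇒≤α l))

  length-part≤⇒ : ∀ u {i} → length (part u) ≤ i → length u ≤ α i
  length-part≤⇒ u l = h≤⇒≤α (subst (_≤ _) (length-part u) l)

  ≤⇒length-part≤ : ∀ u {i} → length u ≤ α i → length (part u) ≤ i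
  ≤⇒length-part≤ u l = subst (_≤ _) (sym (length-part u)) (≤α⇒h≤ l)

  <length-part⇒ : ∀ u {i} → i < length (part u) → α i < length u
  <length-part⇒ u i< = ≰⇒> λ l →
    <⇒≱ i< (≤⇒length-part≤ u l)

  <⇒<length-part : ∀ u {i} → α i < length u → i < length (part u)
  <⇒<length-part u αi< = ≰⇒> λ l → <⇒≱ αi< (length-part≤⇒ u l)

  part-mono : ∀ {u u′} → u ⊴ u′ → part u ⊴ part u′
  part-mono {u} {u′} (l , b) =
      subst₂ _≤_ (sym (length-part u)) (sym (length-part u′)) (h-mono l)
    , λ {i} i< → trans (bit-part u′ i) (trans (b (<length-part⇒ u i<)) (sym (bit-part u i)))

evens : Part
evens = record
  { α = double ; h = ⌈_/2⌉
  ; α-mono = λ l → +-mono-≤ l l ; h-mono = ⌈n/2⌉-mono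
  ; unit = ≤double⌈/2⌉ ; counit = λ i → ≤-reflexive (sym (n≡⌈n+n/2⌉ i)) }

odds : Part
odds = record
  { α = double+1 ; h = ⌊_/2⌋
  ; α-mono = λ l → s≤s (+-mono-≤ l l) ; h-mono = ⌊n/2⌋-mono
  -- `⌊ suc n /2⌋` is `⌈ n /2⌉` by definition, so both adjunction laws reduce to facts about
  -- rounding up.
  ; unit = λ { zero → z≤n ; (suc n) → s≤s (≤double⌈/2⌉ n) }
  ; counit = λ i → ≤-reflexive (sym (n≡⌈n+n/2⌉ i)) }

-- Interleaving two sequences

weave : (ℕ → Bool) → (ℕ → Bool) → ℕ → Bool
weave f g zero    = f zero
weave f g (suc n) = weave g (f ∘ suc) n

weave-even : ∀ f g i → weave f g (double i) ≡ f i
weave-even f g zero    = refl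
weave-even f g (suc i) rewrite +-suc i i = weave-even (f ∘ suc) (g ∘ suc) i

weave-odd : ∀ f g i → weave f g (double+1 i) ≡ g i
weave-odd f g i = weave-even g (f ∘ suc) i

module _ (s t : List Bool) where
  private
    k : ℕ
    -- A common bound of both lengths: each sequence is padded by zeros up to `k`. A zero makes no
    -- claim in the Mathias order.
    k = length s + length t

    beyond : ∀ i → double k ≤ i → weave (bit s) (bit t) i ≡ false
    beyond n l with parity n
    ... | even i = trans (weave-even (bit s) (bit t) i) (bit-beyond s
      (≤-trans (m≤m+n _ (length t)) (subst (_≤ i) (sym (n≡⌈n+n/2⌉ k)) (Part.≤α⇒h≤ evens l))))
    ... | odd i  = trans (weave-odd (bit s) (bit t) i) (bit-beyond t
      (≤-trans (m≤n+m _ (length s)) (subst (_≤ i) (sym (n≡⌊n+n/2⌋ k)) (Part.≤α⇒h≤ odds l))))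

  interleave : List Bool
  interleave = applyUpTo (weave (bit s) (bit t)) (double k)

  length-interleave : length interleave ≡ double k
  length-interleave = length-applyUpTo _ (double k)

  bit-interleave-even : ∀ i → bit interleave (double i) ≡ bit s i
  bit-interleave-even i =
    trans (bit-applyUpTo _ (double k) beyond (double i)) (weave-even (bit s) (bit t) i)

  bit-interleave-odd : ∀ i → bit interleave (double+1 i) ≡ bit t i
  bit-interleave-odd i =
    trans (bit-applyUpTo _ (double k) beyond (double+1 i)) (weave-odd (bit s) (bit t) i)

  bit-evens-interleave : ∀ i → bit (Part.part evens interleave) i ≡ bit s i
  bit-evens-interleave i = trans (Part.bit-part evens interleave i) (bit-interleave-even i)

  bit-odds-interleave : ∀ i → bit (Part.part odds interleave) i ≡ bit t i
  bit-odds-interleave i = trans (Part.bit-part odds interleave i) (bit-interleave-odd i)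

  ⊴evens-interleave : s ⊴ Part.part evens interleave
  ⊴evens-interleave =
      ≤-trans (m≤m+n _ (length t)) (≤-reflexive (sym (trans
        (trans (Part.length-part evens interleave) (cong ⌈_/2⌉ length-interleave))
        (sym (n≡⌈n+n/2⌉ k)))))
    , λ {i} _ → bit-evens-interleave i

  ⊴odds-interleave : t ⊴ Part.part odds interleave
  ⊴odds-interleave =
      ≤-trans (m≤n+m _ (length s)) (≤-reflexive (sym (trans
        (trans (Part.length-part odds interleave) (cong ⌊_/2⌋ length-interleave))
        (sym (n≡⌊n+n/2⌋ k)))))
    , λ {i} _ → bit-odds-interleave i

  ⊴interleave : ∀ {u} → Part.part evens u ⊴ s → Part.part odds u ⊴ t → u ⊴ interleave
  ⊴interleave {u} (l₀ , b₀) (_ , b₁) =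
      -- The even part has the rounded-up half of the length of `u`, so bounding it bounds all of
      -- `u`.
      ≤-trans (Part.length-part≤⇒ evens u l₀)
        (≤-trans (Part.α-mono evens {length s} (m≤m+n _ (length t)))
          (≤-reflexive (sym length-interleave)))
    , λ {i} → bits (parity i)
    where
    bits : ∀ {i} → Parity i → i < length u → bit interleave i ≡ bit u i
    bits (even i) i< = trans (bit-interleave-even i)
      (trans (b₀ (Part.<⇒<length-part evens u i<)) (Part.bit-part evens u i))
    bits (odd i) i< = trans (bit-interleave-odd i)
      (trans (b₁ (Part.<⇒<length-part odds u i<)) (Part.bit-part odds u i))

-- Semantics of universes

-- The clauses that the forcing relation satisfies.  The points
-- of a model of U [ ℙ ] are the pairs of a point x of U and a condition valid at x, so that
-- an iterated extension is treated like a single one.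
record Model (U : Universe) : Set₁ where
  open Universe U
  infix 0 _⊩_ _⊑_
  field
    Point   : Set
    _⊑_     : Point → Point → Set
    _⊩_     : Point → Ω → Set
    ⊑-refl  : ∀ {x} → x ⊑ x
    ⊑-trans : ∀ {x y z} → x ⊑ y → y ⊑ z → x ⊑ z
    ⌜⌝⁺     : ∀ {x A} → A → x ⊩ ⌜ A ⌝
    ⌜⌝⁻     : ∀ {x A} → x ⊩ ⌜ A ⌝ → A
    ∧⁺      : ∀ {x φ ψ} → (x ⊩ φ) → (x ⊩ ψ) → x ⊩ φ ∧ ψ
    ∧⁻      : ∀ {x φ ψ} → (x ⊩ φ ∧ ψ) → (x ⊩ φ) × (x ⊩ ψ)
    ~⁺      : ∀ {x φ} → (∀ {y} → y ⊑ x → ¬ (y ⊩ φ)) → x ⊩ ~ φ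
    ~⁻      : ∀ {x y φ} → (x ⊩ ~ φ) → y ⊑ x → ¬ (y ⊩ φ)
    ⋀⁺      : ∀ {x} {I : Set} {φ : I → Ω} → (∀ i → x ⊩ φ i) → x ⊩ ⋀ φ
    ⋀⁻      : ∀ {x} {I : Set} {φ : I → Ω} → (x ⊩ ⋀ φ) → ∀ i → x ⊩ φ i
    ∋-mono  : ∀ {x y} {A : Set} {X : Sub A} {a} → y ⊑ x → (x ⊩ X ∋ a) → y ⊩ X ∋ a
    sep⁺    : ∀ {x} {A : Set} {φ : A → Ω} {a} → (x ⊩ φ a) → x ⊩ sep φ ∋ a

module _ (em : ExcludedMiddle 0ℓ) where

  dne : {A : Set} → ¬ ¬ A → A
  dne = decidable-stable em

  module Semantics {U : Universe} (M : Model U) where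
    open Universe U
    open Sets U
    open Model M public

    -- `Regular φ` says that the points forcing `φ` form a regular open set. `∨`, `⇒` and `⋁` are
    -- negations, hence regular once the negated sentence is monotone; for the atoms `X ∋ a` a model
    -- only provides monotonicity.
    Mono Stable Regular : Ω → Set
    Mono φ    = ∀ {x y} → y ⊑ x → (x ⊩ φ) → y ⊩ φ
    Stable φ  = ∀ {x} → (∀ {y} → y ⊑ x → ∃ λ z → (z ⊑ y) × (z ⊩ φ)) → x ⊩ φ
    Regular φ = Mono φ × Stable φ

    ⌜⌝-mono : ∀ {A} → Mono ⌜ A ⌝
    ⌜⌝-mono _ = ⌜⌝⁺ ∘ ⌜⌝⁻

    ~-mono : ∀ {φ} → Mono (~ φ)
    ~-mono y⊑x p = ~⁺ λ z⊑y → ~⁻ p (⊑-trans z⊑y y⊑x)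

    ~-regular : ∀ {φ} → Mono φ → Regular (~ φ)
    ~-regular mono = ~-mono , λ d → ~⁺ λ y⊑x q →
      let z , z⊑y , ¬q = d y⊑x in ~⁻ ¬q ⊑-refl (mono z⊑y q)

    ∧-mono : ∀ {φ ψ} → Mono φ → Mono ψ → Mono (φ ∧ ψ)
    ∧-mono m n y⊑x p = ∧⁺ (m y⊑x (proj₁ (∧⁻ p))) (n y⊑x (proj₂ (∧⁻ p)))

    ⋀-mono : ∀ {I : Set} {φ : I → Ω} → (∀ i → Mono (φ i)) → Mono (⋀ φ)
    ⋀-mono m y⊑x p = ⋀⁺ λ i → m i y⊑x (⋀⁻ p i)

    ⋁-regular : ∀ {I : Set} {φ : I → Ω} → Regular (⋁ φ)
    ⋁-regular = ~-regular (⋀-mono λ _ → ~-mono)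

    -- `⋁` is `~ ⋀ ~`, so a witness appears only after strengthening: if no stronger point had one,
    -- `x` would force every `~ φ i`.
    ⋁⁻ : ∀ {I : Set} {φ : I → Ω} {x} → (x ⊩ ⋁ φ) → ∃ λ y → (y ⊑ x) × ∃ λ i → y ⊩ φ i
    ⋁⁻ p = dne λ none → ~⁻ p ⊑-refl (⋀⁺ λ i → ~⁺ λ y⊑x q → none (_ , y⊑x , i , q))

    ⋁⁺-dense : ∀ {I : Set} {φ : I → Ω} {x} →
               (∀ {y} → y ⊑ x → ∃ λ z → (z ⊑ y) × ∃ λ i → z ⊩ φ i) → x ⊩ ⋁ φ
    ⋁⁺-dense d = ~⁺ λ y⊑x none → let z , z⊑y , i , p = d y⊑x in ~⁻ (⋀⁻ none i) z⊑y p

    ⋁⁺ : ∀ {I : Set} {φ : I → Ω} {x} i → Mono (φ i) → (x ⊩ φ i) → x ⊩ ⋁ φ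
    ⋁⁺ i m p = ⋁⁺-dense λ y⊑x → _ , ⊑-refl , i , m y⊑x p

    ⇒-mono : ∀ {φ ψ} → Mono (φ ⇒ ψ)
    ⇒-mono = ~-mono

    ⇒⁺ : ∀ {φ ψ x} → (∀ {y} → y ⊑ x → (y ⊩ φ) → y ⊩ ψ) → x ⊩ φ ⇒ ψ
    ⇒⁺ f = ~⁺ λ y⊑x p → ~⁻ (proj₂ (∧⁻ p)) ⊑-refl (f y⊑x (proj₁ (∧⁻ p)))

    ⇒⁻-dense : ∀ {φ ψ x} → (x ⊩ φ ⇒ ψ) → (x ⊩ φ) → ∃ λ y → (y ⊑ x) × (y ⊩ ψ)
    ⇒⁻-dense p q = dne λ none → ~⁻ p ⊑-refl (∧⁺ q (~⁺ λ y⊑x r → none (_ , y⊑x , r)))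

    -- Modus ponens first yields `ψ` at some stronger point. Repeating it below every `y ⊑ x` makes
    -- `ψ` dense below `x`, and stability brings it back to `x`.
    ⇒⁻ : ∀ {φ ψ x} → Mono φ → Stable ψ → (x ⊩ φ ⇒ ψ) → (x ⊩ φ) → x ⊩ ψ
    ⇒⁻ m s p q = s λ y⊑x → ⇒⁻-dense (⇒-mono y⊑x p) (m y⊑x q)

    mem-regular : ∀ τ {a X} → Regular (mem τ a X)
    mem-regular τ = ⋁-regular

    mem-mono : ∀ τ {a X} → Mono (mem τ a X)
    mem-mono τ = proj₁ (mem-regular τ)

    mem-stable : ∀ τ {a X} → Stable (mem τ a X)
    mem-stable τ = proj₂ (mem-regular τ)

    eq-mono : ∀ τ {a b} → Mono (eq τ a b)
    eq-mono (base A) = ⌜⌝-mono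
    eq-mono (𝒫 τ)    = ⋀-mono λ _ → ∧-mono ⇒-mono ⇒-mono

    eq-refl : ∀ τ {a x} → x ⊩ eq τ a a
    eq-refl (base A) = ⌜⌝⁺ refl
    eq-refl (𝒫 τ)    = ⋀⁺ λ _ → ∧⁺ (⇒⁺ λ _ → id) (⇒⁺ λ _ → id)

    ≈⁻ : ∀ τ {X Y x} → (x ⊩ eq (𝒫 τ) X Y) → ∀ a → (x ⊩ mem τ a X) → x ⊩ mem τ a Y
    ≈⁻ τ p a = ⇒⁻ (mem-mono τ) (mem-stable τ) (proj₁ (∧⁻ (⋀⁻ p a)))

    ≈⁻ʳ : ∀ τ {X Y x} → (x ⊩ eq (𝒫 τ) X Y) → ∀ a → (x ⊩ mem τ a Y) → x ⊩ mem τ a X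
    ≈⁻ʳ τ p a = ⇒⁻ (mem-mono τ) (mem-stable τ) (proj₂ (∧⁻ (⋀⁻ p a)))

    mem⁺-dense : ∀ τ {a X x} →
                 (∀ {y} → y ⊑ x → ∃ λ z → (z ⊑ y) × ∃ λ b → (z ⊩ X ∋ b) × (z ⊩ eq τ b a)) →
                 x ⊩ mem τ a X
    mem⁺-dense τ d = ⋁⁺-dense λ l →
      let z , k , b , p , q = d l in z , k , b , ∧⁺ p q

    mem⁺ : ∀ τ {a X x} → (x ⊩ X ∋ a) → x ⊩ mem τ a X
    mem⁺ τ p = ⋁⁺ _ (∧-mono ∋-mono (eq-mono τ)) (∧⁺ p (eq-refl τ))

    mem⁻ : ∀ τ {a X x} → (x ⊩ mem τ a X) →
           ∃ λ y → (y ⊑ x) × ∃ λ b → (y ⊩ X ∋ b) × (y ⊩ eq τ b a)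
    mem⁻ τ p = let y , l , b , q = ⋁⁻ p in y , l , b , ∧⁻ q

    ⊆⁺ : ∀ {A B x} → (∀ {y} → y ⊑ x → ∀ n → (y ⊩ mem ω n A) → y ⊩ mem ω n B) → x ⊩ A ⊆ B
    ⊆⁺ f = ⋀⁺ λ n → ⇒⁺ λ l → f l n

    ⊆⁻ : ∀ {A B x} → (x ⊩ A ⊆ B) → ∀ n → (x ⊩ mem ω n A) → x ⊩ mem ω n B
    ⊆⁻ p n = ⇒⁻ (mem-mono ω) (mem-stable ω) (⋀⁻ p n)

    ⊆-mono : ∀ {A B} → Mono (A ⊆ B)
    ⊆-mono = ⋀-mono λ _ → ⇒-mono

    -- Filters and generated filters at a point

    module Filter {𝓕 x} (filter : x ⊩ IsFilter 𝓕) where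

      all∈ : ∀ {A} → (∀ {y} → y ⊑ x → ∀ n → y ⊩ mem ω n A) → x ⊩ mem Pω A 𝓕
      all∈ f = ⇒⁻ (proj₁ ⋁-regular) (mem-stable Pω) (⋀⁻ (proj₁ (∧⁻ filter)) _)
        (⋁⁺ 0 (⋀-mono λ _ → ⇒-mono) (⋀⁺ λ n → ⇒⁺ λ l _ → f l n))

      up : ∀ {A B} → (x ⊩ mem Pω A 𝓕) → (x ⊩ A ⊆ B) → x ⊩ mem Pω B 𝓕
      up p q = ⇒⁻ ⊆-mono (mem-stable Pω)
        (⇒⁻ (mem-mono Pω) (proj₂ (~-regular (∧-mono ⊆-mono ~-mono)))
          (⋀⁻ (⋀⁻ (proj₁ (∧⁻ (proj₂ (∧⁻ (proj₂ (∧⁻ filter)))))) _) _) p) q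

      ∩∈ : ∀ {A B} → (x ⊩ mem Pω A 𝓕) → (x ⊩ mem Pω B 𝓕) → x ⊩ mem Pω (A ∩ B) 𝓕
      ∩∈ p q = ⇒⁻ (mem-mono Pω) (mem-stable Pω)
        (⇒⁻ (mem-mono Pω) (proj₂ (~-regular (∧-mono (mem-mono Pω) ~-mono)))
          (⋀⁻ (⋀⁻ (proj₂ (∧⁻ (proj₂ (∧⁻ (proj₂ (∧⁻ filter)))))) _) _) p) q

    Generates : El U (𝒫 Pω) → El U Pω → List (El U Pω) → Ω
    Generates 𝓖 A Xs =
        (⋀ λ i → mem Pω (lookup Xs i) 𝓖)
      ∧ (⋀ λ n → (⋀ λ i → mem ω n (lookup Xs i)) ⇒ mem ω n A)

    Generates-mono : ∀ {𝓖 A Xs} → Mono (Generates 𝓖 A Xs)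
    Generates-mono = ∧-mono (⋀-mono λ _ → mem-mono Pω) (⋀-mono λ _ → ⇒-mono)

    Generates⁺ : ∀ {𝓖 A Xs x} → (∀ i → x ⊩ mem Pω (lookup Xs i) 𝓖) →
                 (∀ {y} → y ⊑ x → ∀ n → (∀ i → y ⊩ mem ω n (lookup Xs i)) → y ⊩ mem ω n A) →
                 x ⊩ Generates 𝓖 A Xs
    Generates⁺ f g = ∧⁺ (⋀⁺ f) (⋀⁺ λ n → ⇒⁺ λ l p → g l n (⋀⁻ p))

    Generates⁻ : ∀ {𝓖 A Xs x} → (x ⊩ Generates 𝓖 A Xs) →
                 (∀ i → x ⊩ mem Pω (lookup Xs i) 𝓖) ×
                 (∀ n → (∀ i → x ⊩ mem ω n (lookup Xs i)) → x ⊩ mem ω n A)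
    Generates⁻ p =
        ⋀⁻ (proj₁ (∧⁻ p))
      , λ n q → ⇒⁻ (⋀-mono λ _ → mem-mono ω) (mem-stable ω) (⋀⁻ (proj₂ (∧⁻ p)) n) (⋀⁺ q)

    generated⁺ : ∀ {𝓖 A x} Xs → (x ⊩ Generates 𝓖 A Xs) → x ⊩ mem Pω A (generated 𝓖)
    generated⁺ Xs p = mem⁺ Pω (sep⁺ (⋁⁺ Xs (Generates-mono {Xs = Xs}) p))

    -- A family of sets that is closed under binary intersections and densely names
    -- the members of 𝓖 is a base of the filter generated by 𝓖.
    module FilterBase
      {I : Set} (set : I → El U Pω) (top : I) (_⊓_ : I → I → I) {𝓖 : El U (𝒫 Pω)}
      (⊓-left   : ∀ {i j n x} → (x ⊩ mem ω n (set (i ⊓ j))) → x ⊩ mem ω n (set i))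
      (⊓-right  : ∀ {i j n x} → (x ⊩ mem ω n (set (i ⊓ j))) → x ⊩ mem ω n (set j))
      (decode   : ∀ {Y x} → (x ⊩ mem Pω Y 𝓖) → ∃ λ y → (y ⊑ x) × ∃ λ i → y ⊩ eq Pω (set i) Y)
      (sep⁻     : ∀ {A : Set} {φ : A → Ω} {a x} → Mono (φ a) → (x ⊩ sep φ ∋ a) → x ⊩ φ a)
      where

      -- Induction on the list: each member costs one strengthening to be decoded, and its index is
      -- met with the one found so far.
      gather : ∀ Xs {x} → (∀ i → x ⊩ mem Pω (lookup Xs i) 𝓖) →
               ∃ λ y → (y ⊑ x) × ∃ λ i → ∀ {z} → z ⊑ y → ∀ n → (z ⊩ mem ω n (set i)) →
                 ∀ k → z ⊩ mem ω n (lookup Xs k)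
      gather [] _ = _ , ⊑-refl , top , λ _ _ _ ()
      gather (X ∷ Xs) p
        with y , l , i , q ← gather Xs (p ∘ suc)
        with z , k , j , r ← decode (mem-mono Pω l (p zero))
        = z , ⊑-trans k l , i ⊓ j , λ
          { m n s zero     → ≈⁻ ω (eq-mono Pω m r) n (⊓-right s)
          ; m n s (suc k′) → q (⊑-trans m k) n (⊓-left s) k′ }

      base-⊆ : ∀ {A x} → (x ⊩ mem Pω A (generated 𝓖)) →
             ∃ λ y → (y ⊑ x) × ∃ λ i → ∀ {z} → z ⊑ y → ∀ n → (z ⊩ mem ω n (set i)) → z ⊩ mem ω n A
      base-⊆ p
        with y , l , B , q , B≈A ← mem⁻ Pω p
        with z , k , Xs , r ← ⋁⁻ (sep⁻ (proj₁ ⋁-regular) q)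
        with w , j , i , s ← gather Xs (proj₁ (Generates⁻ {Xs = Xs} r))
        = w , ⊑-trans j (⊑-trans k l) , i , λ m n t →
            ≈⁻ ω (eq-mono Pω (⊑-trans m (⊑-trans j k)) B≈A) n
              (proj₂ (Generates⁻ {Xs = Xs} (Generates-mono {Xs = Xs} (⊑-trans m j) r)) n (s m n t))

    -- Reals, domination and unboundedness at a point

    Total Functional : El U Pω×ω → Point → Set
    Total f x      = ∀ n {y} → y ⊑ x → ∃ λ z → (z ⊑ y) × ∃ λ m → z ⊩ mem ω×ω (n , m) f
    Functional f x = ∀ {y} → y ⊑ x → ∀ n m m′ →
      (y ⊩ mem ω×ω (n , m) f) → (y ⊩ mem ω×ω (n , m′) f) → m ≡ m′

    IsReal⁺ : ∀ {f x} → Total f x → Functional f x → x ⊩ IsReal f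
    IsReal⁺ total fun = ∧⁺
      (⋀⁺ λ n → ⋁⁺-dense (total n))
      (⋀⁺ λ n → ⋀⁺ λ m → ⋀⁺ λ m′ → ⇒⁺ λ l p → ⇒⁺ λ k q →
        ⌜⌝⁺ (fun (⊑-trans k l) n m m′ (mem-mono ω×ω k p) q))

    IsReal⁻ : ∀ {f x} → (x ⊩ IsReal f) → Total f x × Functional f x
    IsReal⁻ p =
        (λ n l → ⋁⁻ (proj₁ ⋁-regular l (⋀⁻ (proj₁ (∧⁻ p)) n)))
      , λ l n m m′ q r → ⌜⌝⁻ (proj₂ (proj₂
          (let y , k , s = ⇒⁻-dense (⇒-mono l (⋀⁻ (⋀⁻ (⋀⁻ (proj₂ (∧⁻ p)) n) m) m′)) q
           in ⇒⁻-dense s (mem-mono ω×ω k r))))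

    Below : ℕ → El U Pω×ω → El U Pω×ω → Point → Set
    Below N f g x = ∀ {y} → y ⊑ x → ∀ n → N ≤ n → ∀ m k →
      (y ⊩ mem ω×ω (n , m) f) → (y ⊩ mem ω×ω (n , k) g) → m ≤ k

    ≤*⁺ : ∀ {f g x} → (∀ {y} → y ⊑ x → ∃ λ z → (z ⊑ y) × ∃ λ N → Below N f g z) → x ⊩ f ≤* g
    ≤*⁺ d = ⋁⁺-dense λ l →
      let z , k , N , b = d l
      in z , k , N , ⋀⁺ λ n → ⇒⁺ λ l₁ N≤n → ⋀⁺ λ m → ⋀⁺ λ k → ⇒⁺ λ l₂ p → ⇒⁺ λ l₃ q →
           ⌜⌝⁺ (b (⊑-trans l₃ (⊑-trans l₂ l₁)) n (⌜⌝⁻ N≤n) m k (mem-mono ω×ω l₃ p) q)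

    ≤*⁻ : ∀ {f g x} → (x ⊩ f ≤* g) → ∃ λ y → (y ⊑ x) × ∃ λ N → Below N f g y
    ≤*⁻ p =
      let y , l , N , q = ⋁⁻ p
      in y , l , N , λ {z} z⊑y n N≤n m k r s →
        let _ , l₁ , q₁ = ⇒⁻-dense (⇒-mono z⊑y (⋀⁻ q n)) (⌜⌝⁺ N≤n)
            _ , l₂ , q₂ = ⇒⁻-dense (⋀⁻ (⋀⁻ q₁ m) k) (mem-mono ω×ω l₁ r)
            _ , l₃ , q₃ = ⇒⁻-dense q₂ (mem-mono ω×ω (⊑-trans l₂ l₁) s)
        in ⌜⌝⁻ q₃

    Bounds : El U Pω×ω → El U (𝒫 Pω×ω) → Point → Set
    Bounds g 𝓑 x = ∀ {y} → y ⊑ x → ∀ f → (y ⊩ mem Pω×ω f 𝓑) → y ⊩ f ≤* g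

    Unbounded⁺ : ∀ {𝓑 x} → (∀ {y} → y ⊑ x → ∀ g → Total g y → Functional g y → ¬ Bounds g 𝓑 y) →
                 x ⊩ Unbounded 𝓑
    Unbounded⁺ f = ~⁺ λ l p →
      let y , k , g , q = ⋁⁻ p
          total , fun = IsReal⁻ (proj₁ (∧⁻ q))
      in f (⊑-trans k l) g total fun λ l₁ h r →
           ⇒⁻ (mem-mono Pω×ω) (proj₂ ⋁-regular) (⇒-mono l₁ (⋀⁻ (proj₂ (∧⁻ q)) h)) r

    Unbounded⁻ : ∀ {𝓑 x} → (x ⊩ Unbounded 𝓑) → ∀ g → Total g x → Functional g x → ¬ Bounds g 𝓑 x
    Unbounded⁻ p g total fun bounds = ~⁻ p ⊑-refl (⋁⁺-dense λ l → _ , ⊑-refl , g ,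
      ∧⁺ (IsReal⁺ (λ n k → total n (⊑-trans k l)) (λ k → fun (⊑-trans k l)))
         (⋀⁺ λ f → ⇒⁺ λ k → bounds (⊑-trans k l) f))

  -- The generic extension as a model

  record IsPreorder {U : Universe} (M : Model U) (ℙ : Forcing U) : Set where
    open Semantics M
    open Forcing ℙ
    field
      Valid-mono : ∀ {c} → Mono (Valid c)
      ≼-mono     : ∀ {c d} → Mono (c ≼ d)
      ≼-refl     : ∀ {c x} → x ⊩ (c ≼ c)
      ≼-trans    : ∀ {c d e x} → (x ⊩ (c ≼ d)) → (x ⊩ (d ≼ e)) → x ⊩ (c ≼ e)

  module Generic {U : Universe} (M : Model U) (ℙ : Forcing U) (pre : IsPreorder M ℙ) where
    open Universe U
    open Semantics M
    open Forcing ℙ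
    open IsPreorder pre
    open Extension U ℙ

    model : Model (U [ ℙ ])
    model = record
      { Point   = Σ Point λ x → Σ Cond λ c → x ⊩ Valid c
      ; _⊑_     = λ (y , d , _) (x , c , _) → (y ⊑ x) × (y ⊩ (d ≼ c))
      ; _⊩_     = λ (x , c , _) φ → x ⊩ φ c
      ; ⊑-refl  = ⊑-refl , ≼-refl
      ; ⊑-trans = λ (k , p) (l , q) → ⊑-trans k l , ≼-trans p (≼-mono k q)
      ; ⌜⌝⁺     = ⌜⌝⁺
      ; ⌜⌝⁻     = ⌜⌝⁻
      ; ∧⁺      = ∧⁺
      ; ∧⁻      = ∧⁻
      ; ~⁺      = λ f → ⋀⁺ λ d → ~⁺ λ {y} l p →
                    let v , q = ∧⁻ p in f {y , d , v} (l , proj₁ (∧⁻ q)) (proj₂ (∧⁻ q))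
      ; ~⁻      = λ { {y = y , d , v} p (l , q) r → ~⁻ (⋀⁻ p d) l (∧⁺ v (∧⁺ q r)) }
      ; ⋀⁺      = ⋀⁺
      ; ⋀⁻      = ⋀⁻
      ; ∋-mono  = λ (l , q) p → ⋁⁺-dense λ k →
                    let z , j , r , s = ⋁⁻ (proj₁ ⋁-regular (⊑-trans k l) p)
                        t , u = ∧⁻ s
                    in z , j , r , ∧⁺ t (∧⁺ (proj₁ (∧⁻ u))
                         (≼-trans (≼-mono (⊑-trans j k) q) (proj₂ (∧⁻ u))))
      ; sep⁺    = λ { {x = x , c , v} p →
                    -- The name `sep φ` lists `a` with every condition satisfying `φ a`, so the
                    -- current condition `c` is a witness.
                    ⋁⁺ c (∧-mono ∋-mono (∧-mono Valid-mono ≼-mono))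
                      (∧⁺ (sep⁺ p) (∧⁺ v ≼-refl)) }
      }

    module S = Semantics model

    check-∋⁺ : ∀ τ {X a} x → (proj₁ x ⊩ X ∋ a) →
               x S.⊩ Universe._∋_ (U [ ℙ ]) (check (𝒫 τ) X) (check τ a)
    check-∋⁺ τ {a = a} (_ , c , v) p = ⋁⁺ c (∧-mono ∋-mono (∧-mono Valid-mono ≼-mono))
      (∧⁺ (sep⁺ (∧⁺ v (⋁⁺ a (∧-mono ∋-mono ⌜⌝-mono) (∧⁺ p (⌜⌝⁺ refl)))))
          (∧⁺ v ≼-refl))

    -- At a base type equality has the same meaning in both universes. The listed element itself is
    -- found only densely, which suffices for membership.
    mem-check⁺ : ∀ {A X a} x → (proj₁ x ⊩ Sets.mem U (base A) a X) →
                 x S.⊩ Sets.mem (U [ ℙ ]) (base A) a (check (𝒫 (base A)) X)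
    mem-check⁺ {A} x p = S.mem⁺-dense (base A) {x = x} λ { {y , d , v} (l , _) →
      let z , k , b , q , r = mem⁻ (base A) (mem-mono (base A) l p)
          w = Valid-mono k v
      in (z , d , w) , (k , ≼-refl) , b , check-∋⁺ (base A) (z , d , w) q , r }

    Forces⁺ : ∀ φ {x} → (∀ {y} → y ⊑ x → ∀ c (v : y ⊩ Valid c) → (y , c , v) S.⊩ φ) → x ⊩ Forces φ
    Forces⁺ φ f = ⋀⁺ λ c → ⇒⁺ λ l v → f l c v

    check∈check : ∀ τ {X a} x → (proj₁ x ⊩ X ∋ a) →
                  x S.⊩ Sets.mem (U [ ℙ ]) τ (check τ a) (check (𝒫 τ) X)
    check∈check τ x p = S.mem⁺ τ {x = x} (check-∋⁺ τ x p)

  -- Pulling bounds back along a projection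

  module TwoModels {U W : Universe} (N : Model U) (M : Model W) where
    private
      module N = Semantics N
      module M = Semantics M
      memᴺ = Sets.mem U
      memᴹ = Sets.mem W

    -- A name ĝ for a bound in M is pulled back along the projection π to the name of
    -- { (a , r) : π r ⊩ a ∈ ĝ }, which is then a bound in N.
    module Projection
      (π      : N.Point → M.Point)
      (π-mono : ∀ {r′ r} → r′ N.⊑ r → π r′ M.⊑ π r)
      (lift   : ∀ {r x} → x M.⊑ π r → ∃ λ r′ → (r′ N.⊑ r) × (π r′ M.⊑ x))
      (dense  : ∀ x → ∃ λ r → π r M.⊑ x)
      (comprehension : (φ : ℕ × ℕ → N.Point → Set) →
        (∀ {a r r′} → r′ N.⊑ r → φ a r → φ a r′) →
        ∃ λ g → (∀ {a r} → φ a r → r N.⊩ memᴺ ω×ω a g) ×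
                (∀ {a r} → (r N.⊩ memᴺ ω×ω a g) → ∃ λ r′ → (r′ N.⊑ r) × φ a r′))
      {𝓑 : El U (𝒫 Pω×ω)} {𝓑̂ : El W (𝒫 Pω×ω)}
      (transfer : ∀ {r f} → (r N.⊩ memᴺ Pω×ω f 𝓑) →
        ∃ λ r′ → (r′ N.⊑ r) × ∃ λ f̂ → (∀ x → x M.⊩ memᴹ Pω×ω f̂ 𝓑̂) ×
          (∀ {r″ a} → r″ N.⊑ r′ → (r″ N.⊩ memᴺ ω×ω a f) → ∀ x → x M.⊩ memᴹ ω×ω a f̂))
      where

      module _ (ĝ : El W Pω×ω) where
        private
          pullback = comprehension (λ a r → π r M.⊩ memᴹ ω×ω a ĝ) (M.mem-mono ω×ω ∘ π-mono)
          g  = proj₁ pullback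
          g⁺ = λ {a} {r} → proj₁ (proj₂ pullback) {a} {r}
          g⁻ = λ {a} {r} → proj₂ (proj₂ pullback) {a} {r}

        -- The pulled-back name would bound `𝓑` at `r`. Each clause for `ĝ` is read at images of
        -- points, and `lift` returns to `N` whenever a point of `M` has been strengthened.
        bounded : ∀ {r x} → π r M.⊑ x → M.Total ĝ x → M.Functional ĝ x → M.Bounds ĝ 𝓑̂ x →
                  ¬ (r N.⊩ Sets.Unbounded U 𝓑)
        bounded {r} {x} r≤x total fun bounds unbounded = N.Unbounded⁻ unbounded g gTotal gFun gBounds
          where
          below : ∀ {r′} → r′ N.⊑ r → π r′ M.⊑ x
          below l = M.⊑-trans (π-mono l) r≤x

          gTotal : N.Total g r
          gTotal n l =
            let y , y⊑ , m , p = total n (below l)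
                r′ , r′⊑ , k = lift y⊑
            in r′ , r′⊑ , m , g⁺ (M.mem-mono ω×ω k p)

          gFun : N.Functional g r
          -- Membership in `g` yields membership in `ĝ` only at a stronger point, so two successive
          -- strengthenings place both values at one image.
          gFun l n m m′ p p′ =
            let r₁ , l₁ , q  = g⁻ p
                r₂ , l₂ , q′ = g⁻ (N.mem-mono ω×ω l₁ p′)
            in fun (below (N.⊑-trans l₂ (N.⊑-trans l₁ l))) n m m′ (M.mem-mono ω×ω (π-mono l₂) q) q′

          gBounds : N.Bounds g 𝓑 r
          -- `f` is replaced by a name `f̂` that contains it. The threshold for `f̂` is decided at
          -- `w`, and lifting `w` makes it a threshold for `f`.
          gBounds l f f∈ = N.≤*⁺ λ l₁ →
            let r₁ , k₁ , f̂ , f̂∈ , f⊆f̂ = transfer (N.mem-mono Pω×ω l₁ f∈)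
                w , w⊑ , N , ĝBelow =
                  M.≤*⁻ (bounds (below (N.⊑-trans k₁ (N.⊑-trans l₁ l))) f̂ (f̂∈ _))
                r₂ , k₂ , r₂⊑w = lift w⊑
            in r₂ , N.⊑-trans k₂ k₁ , N , λ l₂ n N≤n m k p q →
              let r₃ , l₃ , q′ = g⁻ q
              in ĝBelow (M.⊑-trans (π-mono (N.⊑-trans l₃ l₂)) r₂⊑w) n N≤n m k
                   (f⊆f̂ (N.⊑-trans l₂ k₂) p _) q′

      unbounded : (∀ r → r N.⊩ Sets.Unbounded U 𝓑) → ∀ {x} → x M.⊩ Sets.Unbounded W 𝓑̂
      unbounded h = M.Unbounded⁺ λ {y} _ ĝ total fun bounds →
        let r , l = dense y in bounded ĝ l total fun bounds (h r)

  -- The Mathias order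

  module MathiasOrder {U : Universe} (M : Model U) (𝓕 : El U (𝒫 Pω)) where
    open Universe U
    open Sets U using (mem)
    open Semantics M
    open Forcing (Mathias U 𝓕)

    -- `adds` ranges over all numbers instead of `Fin (length t)`. Bits beyond the end are false, so
    -- this is the same demand, but its index can be transported between sequences.
    record Stronger (x : Point) (d c : Cond) : Set where
      constructor stronger
      field
        extends : proj₁ c ⊴ proj₁ d
        shrinks : ∀ {y} → y ⊑ x → ∀ n → (y ⊩ mem ω n (proj₂ d)) → y ⊩ mem ω n (proj₂ c)
        adds    : ∀ i → length (proj₁ c) ≤ i → bit (proj₁ d) i ≡ true → x ⊩ mem ω i (proj₂ c)
    open Stronger

    ≼⁺ : ∀ {x d c} → Stronger x d c → x ⊩ (d ≼ c)
    ≼⁺ {d = t , _} {s , _} p = ∧⁺ (⌜⌝⁺ (⊴⇒Prefix s t (extends p))) (∧⁺ (⊆⁺ (shrinks p))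
      (⋀⁺ λ i → ⇒⁺ λ l s≤i → ⇒⁺ λ k ti → mem-mono ω (⊑-trans k l)
        (adds p (toℕ i) (⌜⌝⁻ s≤i) (trans (bit-lookup t i) (⌜⌝⁻ ti)))))

    ≼⁻ : ∀ {x d c} → (x ⊩ (d ≼ c)) → Stronger x d c
    ≼⁻ {x} {t , _} {s , A} p with ext , q ← ∧⁻ p with sub , new ← ∧⁻ q = stronger
      (Prefix⇒⊴ {s} {t} (⌜⌝⁻ ext))
      (λ l → ⊆⁻ (⊆-mono l sub))
      λ i s≤i ti →
        let i< = bit-true⇒< t ti
            j  = fromℕ< i<
            j≡ = toℕ-fromℕ< i<
        in subst (λ k → x ⊩ mem ω k A) j≡
             (⇒⁻ ⌜⌝-mono (mem-stable ω)
               (⇒⁻ ⌜⌝-mono (proj₂ (~-regular (∧-mono ⌜⌝-mono ~-mono))) (⋀⁻ new j)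
                 (⌜⌝⁺ (subst (length s ≤_) (sym j≡) s≤i)))
               (⌜⌝⁺ (trans (sym (bit-lookup t j)) (trans (cong (bit t) j≡) ti))))

    isPreorder : IsPreorder M (Mathias U 𝓕)
    isPreorder = record
      { Valid-mono = mem-mono Pω
      ; ≼-mono     = ∧-mono ⌜⌝-mono (∧-mono ⊆-mono (⋀-mono λ _ → ⇒-mono))
      ; ≼-refl     = λ { {s , _} → ≼⁺ (stronger (⊴-refl {s}) (λ _ _ → id)
                       λ i s≤i si → contradiction (bit-true⇒< s si) (≤⇒≯ s≤i)) }
      ; ≼-trans    = λ p q → ≼⁺ (compose (≼⁻ p) (≼⁻ q))
      }
      where
      -- A new place of `u` either lies within `t`, where the second comparison admits it, or beyond
      -- `t`, where it is in the set of `d` and hence in that of `c`.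
      compose : ∀ {x e d c} → Stronger x e d → Stronger x d c → Stronger x e c
      compose {e = u , _} {t , _} {s , _} p q = stronger
        (⊴-trans {s} {t} {u} (extends q) (extends p))
        (λ l n → shrinks q l n ∘ shrinks p l n)
        λ i s≤i ui → new i s≤i ui (i <? length t)
        where
        new : ∀ i → _ → _ → Dec (i < length t) → _
        new i s≤i ui (yes i<) = adds q i s≤i (trans (sym (proj₂ (extends p) i<)) ui)
        new i s≤i ui (no i≮)  = shrinks q ⊑-refl i (adds p i (≮⇒≥ i≮) ui)

  -- The ground model and its extensions

  T-does⁺ : {A : Set} (d : Dec A) → A → T (does d)
  T-does⁺ (yes _) _ = tt
  T-does⁺ (no ¬a) a = contradiction a ¬a

  T-does⁻ : {A : Set} (d : Dec A) → T (does d) → A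
  T-does⁻ (yes a) _ = a

  ground : Model (V em)
  ground = record
    { Point   = ⊤
    ; _⊑_     = λ _ _ → ⊤
    ; _⊩_     = λ _ φ → φ
    ; ⊑-refl  = tt
    ; ⊑-trans = λ _ _ → tt
    ; ⌜⌝⁺     = id
    ; ⌜⌝⁻     = id
    ; ∧⁺      = _,_
    ; ∧⁻      = id
    ; ~⁺      = λ f → f {tt} tt
    ; ~⁻      = λ f _ → f
    ; ⋀⁺      = id
    ; ⋀⁻      = id
    ; ∋-mono  = λ _ p → p
    ; sep⁺    = λ {_} {_} {φ} {a} → T-does⁺ (em {φ a})
    }

  module Ground = Semantics ground

  open Sets (V em) using (mem; IsFilter; _∩_; _⊕_; _⊕ᶠ_)
  open Universe (V em) using (sep; ⋁)

  ∈sep⁺ : ∀ {A : Set} (φ : A → Set) {a} → φ a → mem (base A) a (sep φ)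
  ∈sep⁺ {A} φ {a} p = Ground.mem⁺ (base A) {a} {sep φ} {tt} (T-does⁺ (em {φ a}) p)

  ∈sep⁻ : ∀ {A : Set} (φ : A → Set) {a} → mem (base A) a (sep φ) → φ a
  ∈sep⁻ {A} φ {a} p with Ground.mem⁻ (base A) {a} {sep φ} {tt} p
  ... | _ , _ , b , q , refl = T-does⁻ (em {φ b}) q

  ⋁⁺ : {I : Set} {φ : I → Set} (i : I) → φ i → ⋁ φ
  ⋁⁺ i p none = none i p

  ⋁⁻ : {I : Set} {φ : I → Set} → ⋁ φ → ∃ φ
  ⋁⁻ p = dne λ none → p λ i q → none (i , q)

  ⊕-even⁺ : ∀ A B {n} → mem ω n A → mem ω (double n) (A ⊕ B)
  ⊕-even⁺ A B {n} p = ∈sep⁺ _ λ (¬p , _) → ¬p (⋁⁺ n (p , sym (2*≡double n)))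

  ⊕-odd⁺ : ∀ A B {n} → mem ω n B → mem ω (double+1 n) (A ⊕ B)
  ⊕-odd⁺ A B {n} p = ∈sep⁺ _ λ (_ , ¬p) → ¬p (⋁⁺ n (p , sym (2*+1≡double+1 n)))

  ⊕⁻ : ∀ A B {k} → mem ω k (A ⊕ B) →
       (∃ λ n → mem ω n A × k ≡ double n) ⊎ (∃ λ n → mem ω n B × k ≡ double+1 n)
  ⊕⁻ A B p = dne λ neither → ∈sep⁻ _ p
    ( (λ q → let n , n∈A , eq = ⋁⁻ q in neither (inj₁ (n , n∈A , trans eq (2*≡double n))))
    , (λ q → let n , n∈B , eq = ⋁⁻ q in neither (inj₂ (n , n∈B , trans eq (2*+1≡double+1 n)))) )

  ⊕-even⁻ : ∀ A B {n} → mem ω (double n) (A ⊕ B) → mem ω n A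
  ⊕-even⁻ A B {n} p with ⊕⁻ A B p
  ... | inj₁ (m , q , eq) = subst (λ k → mem ω k A) (sym (double-injective n m eq)) q
  ... | inj₂ (m , _ , eq) = ⊥-elim (double≢double+1 n m eq)

  ⊕-odd⁻ : ∀ A B {n} → mem ω (double+1 n) (A ⊕ B) → mem ω n B
  ⊕-odd⁻ A B {n} p with ⊕⁻ A B p
  ... | inj₁ (m , _ , eq) = ⊥-elim (double≢double+1 m n (sym eq))
  ... | inj₂ (m , q , eq) = subst (λ k → mem ω k B) (sym (double-injective n m (suc-injective eq))) q

  ⊕ᶠ⁺ : ∀ 𝓕₀ 𝓕₁ {A B} → mem Pω A 𝓕₀ → mem Pω B 𝓕₁ → mem Pω (A ⊕ B) (𝓕₀ ⊕ᶠ 𝓕₁)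
  ⊕ᶠ⁺ 𝓕₀ 𝓕₁ {A} {B} p q = Ground.mem⁺ Pω {X = 𝓕₀ ⊕ᶠ 𝓕₁} {tt} (T-does⁺ em
    (⋁⁺ A (⋁⁺ B (p , q , Ground.eq-refl Pω {A ⊕ B} {tt}))))

  ⊕ᶠ⁻ : ∀ 𝓕₀ 𝓕₁ {C} → mem Pω C (𝓕₀ ⊕ᶠ 𝓕₁) → ∃ λ A → ∃ λ B →
        mem Pω A 𝓕₀ × mem Pω B 𝓕₁ × (∀ n → mem ω n (A ⊕ B) → mem ω n C)
  ⊕ᶠ⁻ 𝓕₀ 𝓕₁ {C} p =
    let _ , _ , D , q , D≈C = Ground.mem⁻ Pω {C} {𝓕₀ ⊕ᶠ 𝓕₁} {tt} p
        A , r = ⋁⁻ (T-does⁻ em q)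
        B , A∈ , B∈ , D≈A⊕B = ⋁⁻ r
    in A , B , A∈ , B∈ , λ n → Ground.≈⁻ ω {D} {C} {tt} D≈C n ∘ Ground.≈⁻ʳ ω {D} {A ⊕ B} {tt} D≈A⊕B n

  module Over (ℙ : Forcing (V em)) (pre : IsPreorder ground ℙ) where
    open Generic ground ℙ pre public
    open Forcing ℙ
    open Extension (V em) ℙ using (check)
    open Universe (V em [ ℙ ]) using (Ω) renaming (_∋_ to _∋′_; sep to sep′)

    -- The listing provides some weaker condition `r` satisfying `φ a`; monotonicity carries this
    -- down to `x`.
    sep⁻ : ∀ {A : Set} {φ : A → Ω} {a x} → S.Mono (φ a) → (x S.⊩ sep′ φ ∋′ a) → x S.⊩ φ a
    sep⁻ {φ = φ} {a} {x} mono p with ⋁⁻ p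
    ... | r , q , v , l = mono {tt , r , v} {x} (tt , l) (T-does⁻ (em {φ a r}) q)

    check-∋⁻ : ∀ τ {X a x} → (x S.⊩ check (𝒫 τ) X ∋′ a) → ∃ λ b → T (X b) × a ≡ check τ b
    check-∋⁻ τ p = let _ , q , _ = ⋁⁻ p in ⋁⁻ (proj₂ (T-does⁻ em q))

    -- Elements listed in a canonical name are literally canonical, and equality at a base type is
    -- absolute. Ground membership can thus be read off at any single point.
    mem-check⁻ : ∀ {A : Set} {X a x} → 
                 (x S.⊩ Sets.mem (V em [ ℙ ]) (base A) a (check (𝒫 (base A)) X)) → mem (base A) a X
    mem-check⁻ {A} {X} {a} {x} p with S.mem⁻ (base A) {x = x} p
    ... | y , _ , b , q , refl with check-∋⁻ (base A) {X} {b} {y} q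
    ... | _ , b∈X , refl = Ground.mem⁺ (base A) {b} {X} {tt} b∈X

    -- Over the ground model, excluded middle turns any predicate on points into a set of pairs. So
    -- `φ` may be the forcing relation of another universe, as it is when a bound is pulled back.
    comprehension : {A : Set} (φ : A → S.Point → Set) → (∀ {a x y} → y S.⊑ x → φ a x → φ a y) →
                    ∃ λ X → (∀ {a x} → φ a x → x S.⊩ Sets.mem (V em [ ℙ ]) (base A) a X) ×
                            (∀ {a x} → (x S.⊩ Sets.mem (V em [ ℙ ]) (base A) a X) →
                              ∃ λ y → (y S.⊑ x) × φ a y)
    comprehension {A} φ mono = sep′ ψ
      , (λ {a} {x} p → S.mem⁺ (base A) {a} {sep′ ψ} {x} (S.sep⁺ {x} {φ = ψ} {a} (proj₂ (proj₂ x) , p)))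
      , λ {a} {x} → elim {a} {x}
      where
      ψ : A → Ω
      ψ a c = Σ (Valid c) λ v → φ a (tt , c , v)

      elim : ∀ {a x} → (x S.⊩ Sets.mem (V em [ ℙ ]) (base A) a (sep′ ψ)) → ∃ λ y → (y S.⊑ x) × φ a y
      elim {a} {x} p with S.mem⁻ (base A) {a} {sep′ ψ} {x} p
      ... | y , l , _ , q , refl =
        let v , r = sep⁻ {φ = ψ} {a} {y} (λ {x} {z} k (v , r) → proj₂ (proj₂ z) ,
                      mono {a} {tt , proj₁ (proj₂ x) , v} {z} k r) q
        -- The validity proof `v` found in the name may differ from the one carried by `y`;
        -- monotonicity along reflexivity exchanges them.
        in y , l , mono {a} {tt , proj₁ (proj₂ y) , v} {y} (S.⊑-refl {y}) r

    -- Strengthening decides which ground set `X` is. From then on its forced elements really belong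
    -- to that set.
    check-elements : ∀ {A : Set} {𝓑 X x} →
      (x S.⊩ Sets.mem (V em [ ℙ ]) (𝒫 (base A)) X (check (𝒫 (𝒫 (base A))) 𝓑)) →
      ∃ λ y → (y S.⊑ x) × ∃ λ X₀ → T (𝓑 X₀) ×
        (∀ {z a} → z S.⊑ y → (z S.⊩ Sets.mem (V em [ ℙ ]) (base A) a X) → mem (base A) a X₀)
    check-elements {A} {𝓑} {X} {x} X∈
      with y , l , X′ , X′∈ , X′≈X ← S.mem⁻ (𝒫 (base A)) {x = x} X∈
      with X₀ , X₀∈ , refl ← check-∋⁻ (𝒫 (base A)) {𝓑} {X′} {y} X′∈
      = y , l , X₀ , X₀∈ , λ {z} {a} k p → mem-check⁻ {x = z}
          (S.≈⁻ʳ (base A) {x = z} (S.eq-mono (𝒫 (base A)) {x = y} {z} k X′≈X) a p)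

  -- Two-step iteration and projection from Mathias forcing with the sum filter

  module Iteration (𝓕₀ 𝓕₁ : El (V em) (𝒫 Pω)) (filter₀ : IsFilter 𝓕₀) (filter₁ : IsFilter 𝓕₁) where

    module Filter₀ = Ground.Filter {𝓕₀} {tt} filter₀
    module Filter₁ = Ground.Filter {𝓕₁} {tt} filter₁

    𝕄₁ 𝕄⊕ : Forcing (V em)
    𝕄₁ = Mathias (V em) 𝓕₁
    𝕄⊕ = Mathias (V em) (𝓕₀ ⊕ᶠ 𝓕₁)

    module Order₁ = MathiasOrder ground 𝓕₁
    module Order⊕ = MathiasOrder ground (𝓕₀ ⊕ᶠ 𝓕₁)
    module M₁ = Over 𝕄₁ Order₁.isPreorder
    module M⊕ = Over 𝕄⊕ Order⊕.isPreorder

    check₁ : ∀ τ → El (V em) τ → El (V em [ 𝕄₁ ]) τ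
    check₁ = Extension.check (V em) 𝕄₁

    V[G] : Universe
    V[G] = V em [ 𝕄₁ ]

    𝓕̌₀ : El V[G] (𝒫 Pω)
    𝓕̌₀ = check₁ (𝒫 Pω) 𝓕₀

    gen : El V[G] (𝒫 Pω)
    gen = Sets.generated V[G] 𝓕̌₀

    𝕄₀ : Forcing V[G]
    𝕄₀ = Mathias V[G] gen

    module Order₀ = MathiasOrder M₁.model gen
    module M₀ = Generic M₁.model 𝕄₀ Order₀.isPreorder

    open Model M₁.model using () renaming (Point to Point₁; _⊑_ to _⊑₁_; _⊩_ to _⊩₁_)
    open Model M₀.model using () renaming (Point to Point₀; _⊑_ to _⊑₀_; _⊩_ to _⊩₀_)
    open Model M⊕.model using () renaming (Point to Point⊕; _⊑_ to _⊑⊕_; _⊩_ to _⊩⊕_)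

    mem₁ : ∀ τ → El V[G] τ → El V[G] (𝒫 τ) → Universe.Ω V[G]
    mem₁ = Sets.mem V[G]

    ⊑₁-refl : ∀ {x} → x ⊑₁ x
    ⊑₁-refl {x} = M₁.S.⊑-refl {x}

    -- A one-element list suffices. It holds `Y` and not `A`, because `A` is only extensionally
    -- equal to a listed member of `𝓕₀`, and only listed members have their canonical names listed
    -- in `𝓕̌₀`.
    check-gen : ∀ {A x} → mem Pω A 𝓕₀ → x ⊩₁ mem₁ Pω (check₁ Pω A) gen
    check-gen {A} {x} A∈𝓕₀ with Ground.mem⁻ Pω {A} {𝓕₀} {tt} A∈𝓕₀
    ... | _ , _ , Y , Y∈𝓕₀ , Y≈A = M₁.S.generated⁺ {𝓕̌₀} {x = x} Xs
      (M₁.S.Generates⁺ {𝓕̌₀} {Xs = Xs} {x = x}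
        (λ { zero → M₁.S.mem⁺ Pω {X = 𝓕̌₀} {x} (M₁.check-∋⁺ Pω x Y∈𝓕₀) })
        (λ {y} _ n n∈ → M₁.mem-check⁺ y
            (Ground.≈⁻ ω {Y} {A} {tt} Y≈A n (M₁.mem-check⁻ {x = y} (n∈ zero)))))
      where
      Xs = check₁ Pω Y ∷ []

    decode : ∀ {Y x} → (x ⊩₁ mem₁ Pω Y 𝓕̌₀) → ∃ λ y → (y ⊑₁ x) ×
             ∃ λ ((X , _) : Σ (El (V em) Pω) λ X → mem Pω X 𝓕₀) →
             y ⊩₁ Sets.eq V[G] Pω (check₁ Pω X) Y
    decode {Y} {x} Y∈
      with z , k , Y′ , Y′∈ , Y′≈Y ← M₁.S.mem⁻ Pω {Y} {𝓕̌₀} {x} Y∈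
      with X , X∈ , refl ← M₁.check-∋⁻ Pω {𝓕₀} {Y′} {z} Y′∈
      = z , k , (X , Ground.mem⁺ Pω {X} {𝓕₀} {tt} X∈) , Y′≈Y

    module Base₀ = M₁.S.FilterBase {Σ (El (V em) Pω) λ X → mem Pω X 𝓕₀} (λ (X , _) → check₁ Pω X)
      (sep (λ _ → ⊤) , Filter₀.all∈ λ _ _ → ∈sep⁺ _ tt)
      (λ (X , X∈) (Y , Y∈) → X ∩ Y , Filter₀.∩∈ X∈ Y∈)
      {𝓕̌₀}
      (λ {_} {_} {_} {x} p → M₁.mem-check⁺ x (proj₁ (∈sep⁻ _ (M₁.mem-check⁻ {x = x} p))))
      (λ {_} {_} {_} {x} p → M₁.mem-check⁺ x (proj₂ (∈sep⁻ _ (M₁.mem-check⁻ {x = x} p))))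
      (λ {Y} {x} → decode {Y} {x})
      (λ {_} {φ} {a} {x} → M₁.sep⁻ {φ = φ} {a} {x})

    -- Canonical names of members of `𝓕₀` form a base of the generated filter, since finite
    -- intersections can be taken in the ground model.
    gen⁻ : ∀ {A x} → (x ⊩₁ mem₁ Pω A gen) →
           ∃ λ y → (y ⊑₁ x) × ∃ λ X → mem Pω X 𝓕₀ × (∀ n → mem ω n X → y ⊩₁ mem₁ ω n A)
    gen⁻ {A} {x} A∈ =
      let y , l , (X , X∈) , f = Base₀.base-⊆ {A} {x} A∈
      in y , l , X , X∈ , λ n n∈ → f {y} (⊑₁-refl {y}) n (M₁.mem-check⁺ y n∈)

    preimage : (ℕ → ℕ) → El (V em) Pω → El (V em) Pω
    preimage α C = sep λ n → mem ω (α n) C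

    pull : Part → List Bool × El (V em) Pω → List Bool × El (V em) Pω
    pull P (u , C) = Part.part P u , preimage (Part.α P) C

    -- By the adjunction between `h` and `α`, a place `i` beyond the part of `u` is a place `α i`
    -- beyond `u`, where new elements must lie in the old set.
    pull-mono : ∀ P {d c} → Order⊕.Stronger tt d c → Order₁.Stronger tt (pull P d) (pull P c)
    pull-mono P {u′ , _} {u , _} p = Order₁.stronger
      (Part.part-mono P {u} {u′} (Order⊕.Stronger.extends p))
      (λ _ n → ∈sep⁺ _ ∘ Order⊕.Stronger.shrinks p tt (Part.α P n) ∘ ∈sep⁻ _)
      λ i l b → ∈sep⁺ _ (Order⊕.Stronger.adds p (Part.α P i) (Part.length-part≤⇒ P u l)
        (trans (sym (Part.bit-part P u′ i)) b))

    checkᶜ : List Bool × El (V em) Pω → List Bool × El V[G] Pω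
    checkᶜ (s , A) = s , check₁ Pω A

    check-stronger : ∀ {x d c} → Order₁.Stronger tt d c → Order₀.Stronger x (checkᶜ d) (checkᶜ c)
    check-stronger {x} p = Order₀.stronger (Order₁.Stronger.extends p)
      (λ {y} _ n → M₁.mem-check⁺ y ∘ Order₁.Stronger.shrinks p tt n ∘ M₁.mem-check⁻ {x = y})
      λ i l b → M₁.mem-check⁺ x (Order₁.Stronger.adds p i l b)

    evens-valid : ∀ {C} → mem Pω C (𝓕₀ ⊕ᶠ 𝓕₁) → mem Pω (preimage double C) 𝓕₀
    evens-valid C∈ = let A , B , A∈ , _ , ⊆C = ⊕ᶠ⁻ 𝓕₀ 𝓕₁ C∈ in
      Filter₀.up {A} A∈ (Ground.⊆⁺ {A} {x = tt} λ _ n n∈A →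
        ∈sep⁺ _ (⊆C (double n) (⊕-even⁺ A B {n} n∈A)))

    odds-valid : ∀ {C} → mem Pω C (𝓕₀ ⊕ᶠ 𝓕₁) → mem Pω (preimage double+1 C) 𝓕₁
    odds-valid C∈ = let A , B , _ , B∈ , ⊆C = ⊕ᶠ⁻ 𝓕₀ 𝓕₁ C∈ in
      Filter₁.up {B} B∈ (Ground.⊆⁺ {B} {x = tt} λ _ n n∈B →
        ∈sep⁺ _ (⊆C (double+1 n) (⊕-odd⁺ A B {n} n∈B)))

    -- Even places go to the second step of the iteration, which concerns 𝓕₀.
    project₁ : Point⊕ → Point₁
    project₁ (_ , c , v) = tt , pull odds c , odds-valid v

    project : Point⊕ → Point₀
    project r@(_ , c , v) =
      project₁ r , checkᶜ (pull evens c) , check-gen {x = project₁ r} (evens-valid v)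

    project-mono : ∀ {r′ r} → r′ ⊑⊕ r → project r′ ⊑₀ project r
    project-mono {r′} (_ , l) =
        (tt , Order₁.≼⁺ (pull-mono odds (Order⊕.≼⁻ l)))
      , Order₀.≼⁺ {project₁ r′} (check-stronger {project₁ r′} (pull-mono evens (Order⊕.≼⁻ l)))

    -- Lifting a point of the iteration to the sum forcing

    module Lift
      (x₁ y : Point₁) (t : List Bool) (Ȧ : El V[G] Pω) (r : Point⊕) (X : El (V em) Pω)
      (l₁ : x₁ ⊑₁ project₁ r) (y⊑x₁ : y ⊑₁ x₁) (X∈ : mem Pω X 𝓕₀)
      (X⊆Ȧ : ∀ n → mem ω n X → y ⊩₁ mem₁ ω n Ȧ)
      (p₀ : Order₀.Stronger x₁ (t , Ȧ) (checkᶜ (pull evens (proj₁ (proj₂ r)))))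
      where
      private
        u  = proj₁ (proj₁ (proj₂ r))
        C  = proj₂ (proj₁ (proj₂ r))
        s′ = proj₁ (proj₁ (proj₂ y))
        A′ = proj₂ (proj₁ (proj₂ y))

      open Order₁.Stronger
      module O₀ = Order₀.Stronger

      -- The intersection keeps `C′` inside `C` at even places; at odd places `p₁` does so, as `A′`
      -- comes from `y`.
      A₀ = X ∩ preimage double C
      C′ = A₀ ⊕ A′
      u′ = interleave t s′

      A₀∈ : mem Pω A₀ 𝓕₀
      A₀∈ = Filter₀.∩∈ X∈ (evens-valid (proj₂ (proj₂ r)))

      r′ : Point⊕
      r′ = tt , (u′ , C′) , ⊕ᶠ⁺ 𝓕₀ 𝓕₁ A₀∈ (proj₂ (proj₂ y))

      x₁′ = project₁ r′

      p₁ : Order₁.Stronger tt (s′ , A′) (pull odds (u , C))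
      p₁ = Order₁.≼⁻ (IsPreorder.≼-trans Order₁.isPreorder {x = tt} (proj₂ y⊑x₁) (proj₂ l₁))

      below : Order⊕.Stronger tt (u′ , C′) (u , C)
      below = Order⊕.stronger (⊴interleave t s′ {u} (O₀.extends p₀) (extends p₁)) shrink new
        where
        shrink : ⊤ → ∀ n → mem ω n C′ → mem ω n C
        shrink _ n n∈ with ⊕⁻ A₀ A′ n∈
        ... | inj₁ (m , m∈ , refl) = ∈sep⁻ _ (proj₂ (∈sep⁻ _ m∈))
        ... | inj₂ (m , m∈ , refl) = ∈sep⁻ _ (shrinks p₁ tt m m∈)

        new : ∀ i → length u ≤ i → bit u′ i ≡ true → mem ω i C
        new n l b with parity n
        -- Such a place is new in `t`, so `x₁` forces it into the canonical name of the even part of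
        -- `C`; by absoluteness it is really there.
        ... | even i = ∈sep⁻ _ (M₁.mem-check⁻ {x = x₁} (O₀.adds p₀ i
                (Part.≤⇒length-part≤ evens u l) (trans (sym (bit-interleave-even t s′ i)) b)))
        ... | odd i = ∈sep⁻ _ (adds p₁ i
                (Part.≤⇒length-part≤ odds u l) (trans (sym (bit-interleave-odd t s′ i)) b))

      above₁ : Order₁.Stronger tt (pull odds (u′ , C′)) (s′ , A′)
      above₁ = Order₁.stronger (⊴odds-interleave t s′)
        (λ _ n → ⊕-odd⁻ A₀ A′ {n} ∘ ∈sep⁻ _)
        -- Beyond the end of `s′` the interleaving contributes only zeros at odd places.
        λ i l b → contradiction (bit-true⇒< s′ (trans (sym (bit-odds-interleave t s′ i)) b)) (≤⇒≯ l)

      x₁′⊑y : x₁′ ⊑₁ y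
      x₁′⊑y = tt , Order₁.≼⁺ above₁

      x₁′⊑x₁ : x₁′ ⊑₁ x₁
      x₁′⊑x₁ = M₁.S.⊑-trans {x₁′} {y} {x₁} x₁′⊑y y⊑x₁

      above₀ : Order₀.Stronger x₁′ (checkᶜ (pull evens (u′ , C′))) (t , Ȧ)
      above₀ = Order₀.stronger (⊴evens-interleave t s′)
        (λ {z} z⊑ n n∈ → M₁.S.mem-mono ω {x = y} {z} (M₁.S.⊑-trans {z} {x₁′} {y} z⊑ x₁′⊑y)
          (X⊆Ȧ n (proj₁ (∈sep⁻ _ (⊕-even⁻ A₀ A′ {n} (∈sep⁻ _ (M₁.mem-check⁻ {x = z} n∈)))))))
        λ i l b → contradiction (bit-true⇒< t (trans (sym (bit-evens-interleave t s′ i)) b)) (≤⇒≯ l)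

    lift : ∀ {x r} → x ⊑₀ project r → ∃ λ r′ → (r′ ⊑⊕ r) × (project r′ ⊑₀ x)
    lift {x₁ , (t , Ȧ) , Ȧ∈} {r} (l₁ , l₀) =
      let y , l , X , X∈ , X⊆Ȧ = gen⁻ {Ȧ} {x₁} Ȧ∈
          open Lift x₁ y t Ȧ r X l₁ l X∈ X⊆Ȧ (Order₀.≼⁻ {x₁} l₀)
      in r′ , (tt , Order⊕.≼⁺ below) , (x₁′⊑x₁ , Order₀.≼⁺ {x₁′} above₀)

    -- Every point lies below the image of the condition with empty stem and set `full ⊕ full`, so
    -- density is an instance of `lift`.
    lift-top : ∀ x → ∃ λ r → project r ⊑₀ x
    lift-top x@(x₁ , _) = let r , _ , l = lift {x} {top} (x⊑top x) in r , l
      where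
      full = sep λ (_ : ℕ) → ⊤

      top : Point⊕
      top = tt , ([] , full ⊕ full) , ⊕ᶠ⁺ 𝓕₀ 𝓕₁
        (Filter₀.all∈ λ _ _ → ∈sep⁺ _ tt) (Filter₁.all∈ λ _ _ → ∈sep⁺ _ tt)

      n∈evens : ∀ n → mem ω n (preimage double (full ⊕ full))
      n∈evens n = ∈sep⁺ _ (⊕-even⁺ full full {n} (∈sep⁺ _ tt))

      n∈odds : ∀ n → mem ω n (preimage double+1 (full ⊕ full))
      n∈odds n = ∈sep⁺ _ (⊕-odd⁺ full full {n} (∈sep⁺ _ tt))

      x⊑top : ∀ x → x ⊑₀ project top
      x⊑top (x₁ , _) =
          (tt , Order₁.≼⁺ (Order₁.stronger (z≤n , λ ()) (λ _ n _ → n∈odds n) (λ n _ _ → n∈odds n)))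
        , Order₀.≼⁺ {x₁} (Order₀.stronger (z≤n , λ ())
            (λ {y} _ n _ → M₁.mem-check⁺ y (n∈evens n))
            (λ n _ _ → M₁.mem-check⁺ x₁ (n∈evens n)))

    check₀ : ∀ τ → El V[G] τ → El (V[G] [ 𝕄₀ ]) τ
    check₀ = Extension.check V[G] 𝕄₀

    check⊕ : ∀ τ → El (V em) τ → El (V em [ 𝕄⊕ ]) τ
    check⊕ = Extension.check (V em) 𝕄⊕

    mem⊕ : ∀ τ → El (V em [ 𝕄⊕ ]) τ → El (V em [ 𝕄⊕ ]) (𝒫 τ) → Universe.Ω (V em [ 𝕄⊕ ])
    mem⊕ = Sets.mem (V em [ 𝕄⊕ ])

    mem₀ : ∀ τ → El (V[G] [ 𝕄₀ ]) τ → El (V[G] [ 𝕄₀ ]) (𝒫 τ) → Universe.Ω (V[G] [ 𝕄₀ ])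
    mem₀ = Sets.mem (V[G] [ 𝕄₀ ])

    reals₀ : ∀ {𝓑 f} → T (𝓑 f) → ∀ x →
             x ⊩₀ mem₀ Pω×ω (check₀ Pω×ω (check₁ Pω×ω f)) (check₀ (𝒫 Pω×ω) (check₁ (𝒫 Pω×ω) 𝓑))
    reals₀ {𝓑} {f} f∈ x = M₀.check∈check Pω×ω {check₁ (𝒫 Pω×ω) 𝓑} {check₁ Pω×ω f} x
      (M₁.check-∋⁺ Pω×ω {𝓑} {f} (proj₁ x) f∈)

    values₀ : ∀ {f a} → mem ω×ω a f → ∀ x → x ⊩₀ mem₀ ω×ω a (check₀ Pω×ω (check₁ Pω×ω f))
    values₀ {f} {a} p x = M₀.mem-check⁺ {X = check₁ Pω×ω f} {a} x
      (M₁.mem-check⁺ {X = f} {a} (proj₁ x) p)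

    -- Once `r′` has decided `f` to be a ground real `f₀`, the twice canonical name of `f₀` serves
    -- as `f̂`: its values and its membership in `𝓑` are forced everywhere.
    transfer : ∀ 𝓑 {r f} → (r ⊩⊕ mem⊕ Pω×ω f (check⊕ (𝒫 Pω×ω) 𝓑)) →
               ∃ λ r′ → (r′ ⊑⊕ r) × ∃ λ f̂ →
                 (∀ x → x ⊩₀ mem₀ Pω×ω f̂ (check₀ (𝒫 Pω×ω) (check₁ (𝒫 Pω×ω) 𝓑))) ×
                 (∀ {r″ a} → r″ ⊑⊕ r′ → (r″ ⊩⊕ mem⊕ ω×ω a f) → ∀ x → x ⊩₀ mem₀ ω×ω a f̂)
    transfer 𝓑 {r} {f} f∈ =
      let r′ , l , f₀ , f₀∈ , sub = M⊕.check-elements {ℕ × ℕ} {𝓑} {f} {r} f∈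
      in r′ , l , check₀ Pω×ω (check₁ Pω×ω f₀) , reals₀ {𝓑} {f₀} f₀∈
       , λ {r″} {a} k p → values₀ {f₀} {a} (sub {r″} {a} k p)

    module Transfer (𝓑 : El (V em) (𝒫 Pω×ω)) = TwoModels.Projection M⊕.model M₀.model
      project (λ {r′} {r} → project-mono {r′} {r}) (λ {r} {x} → lift {x} {r}) lift-top
      M⊕.comprehension
      {check⊕ (𝒫 Pω×ω) 𝓑} {check₀ (𝒫 Pω×ω) (check₁ (𝒫 Pω×ω) 𝓑)}
      (λ {r} {f} → transfer 𝓑 {r} {f})

    canjar : ∀ 𝓑 → Canjar (V em) 𝓑 (𝓕₀ ⊕ᶠ 𝓕₁) →
             Extension.Forces (V em) 𝕄₁ (Canjar V[G] (check₁ (𝒫 Pω×ω) 𝓑) gen)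
    canjar 𝓑 hyp = M₁.Forces⁺ (Canjar V[G] (check₁ (𝒫 Pω×ω) 𝓑) gen) {tt} λ _ p p∈ →
      M₀.Forces⁺ (Sets.Unbounded (V[G] [ 𝕄₀ ]) (check₀ (𝒫 Pω×ω) (check₁ (𝒫 Pω×ω) 𝓑))) {tt , p , p∈}
        λ {y} _ q q∈ → Transfer.unbounded 𝓑 unbounded⊕ {y , q , q∈}
      where
      unbounded⊕ : ∀ r → r ⊩⊕ Sets.Unbounded (V em [ 𝕄⊕ ]) (check⊕ (𝒫 Pω×ω) 𝓑)
      -- The implication inside `Forces` is a negated conjunction, hence the appeal to classical
      -- logic.
      unbounded⊕ (_ , r , r∈) = dne λ ¬unb → hyp r (r∈ , ¬unb)

proposition1p3 : (em : ExcludedMiddle 0ℓ) →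
    let open Sets (V em) in
    (𝓕₀ 𝓕₁ : El (V em) (𝒫 Pω)) → IsFilter 𝓕₀ → IsFilter 𝓕₁ →
    (𝓑 : El (V em) (𝒫 Pω×ω)) → AllReal 𝓑 → Unbounded 𝓑 →
    Canjar (V em) 𝓑 (𝓕₀ ⊕ᶠ 𝓕₁) →
    let open Extension (V em) (Mathias (V em) 𝓕₁)
        V[G] = V em [ Mathias (V em) 𝓕₁ ]
    in Forces (Canjar V[G] (check (𝒫 Pω×ω) 𝓑)
                (Sets.generated V[G] (check (𝒫 Pω) 𝓕₀)))
proposition1p3 em 𝓕₀ 𝓕₁ filter₀ filter₁ 𝓑 _ _ = Iteration.canjar em 𝓕₀ 𝓕₁ filter₀ filter₁ 𝓑
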